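{- Let $G=(V,E)$ be a graph. Let $\mathcal{R}(G)$ be the set of all minimal Roman dominating functions on $G$ and $\mathcal{P}(G)$ the set of all minimal perfect Roman dominating functions on $G$. There is a bijection $B:\mathcal{R}(G)\to\mathcal{P}(G)$. Furthermore, $B(f)$ and $B^{ -1}(g)$ can be computed in polynomial time (with respect to the size of $G$) for each $f\in\mathcal{R}(G)$ and each $g\in\mathcal{P}(G)$.
   Context: Graphs are finite, simple and undirected. A function $f:V\to\{0,1,2\}$ is a Roman dominating function on $G=(V,E)$ if every vertex $v$ with $f(v)=0$ has at least one neighbor $u$ with $f(u)=2$; it is a perfect Roman dominating function if every vertex $v$ with $f(v)=0$ has exactly one such neighbor. For $f,g:V\to\{0,1,2\}$ write $f\le g$ if $f(v)\le g(v)$ for all $v\in V$. A (perfect) Roman dominating function $f$ is minimal if there is no (perfect) Roman dominating function $h\neq f$ on $G$ with $h\le f$. The polynomial-time computability is uniform in $G$ (the graph is part of the input). -}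

module Defs where

open import Data.Bool.Base using (if_then_else_)
open import Data.Fin.Base using (Fin; _≤_)
open import Data.Fin.Patterns using (0F; 1F; 2F)
open import Data.List.Base using (List; []; _∷_; _++_; [_]; concat; foldr; length; map; tabulate)
open import Data.Maybe.Base using (Maybe; just; nothing)
open import Data.Nat.Base as ℕ using (ℕ; suc; _+_; _*_)
open import Data.Product.Base using (Σ; ∃; ∃-syntax; _×_; _,_; proj₁)
open import Data.Product using (∃!)
open import Data.Sum.Base using (_⊎_; inj₁; inj₂)
open import Data.Vec.Base as Vec using (Vec)
open import Level using (0ℓ)
open import Relation.Binary.Bundles using (Setoid)
open import Relation.Binary.Core using (Rel)
open import Relation.Binary.Definitions using (Decidable; Irreflexive; Symmetric)
import Relation.Binary.Construct.On as On
open import Relation.Binary.PropositionalEquality using (_≡_; _≗_; _→-setoid_)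
open import Relation.Nullary using (¬_; does)
open import Relation.Unary using (Pred)

------------------------------------------------------------------------
-- Graphs and Roman domination

record Graph : Set₁ where
  field
    order  : ℕ

  V : Set
  V = Fin order

  field
    _~_    : Rel V 0ℓ
    _~?_   : Decidable _~_
    sym    : Symmetric _~_
    irrefl : Irreflexive _≡_ _~_

Labelling : Graph → Set
Labelling G = Graph.V G → Fin 3

module _ (G : Graph) where
  open Graph G

  IsRoman : Pred (Labelling G) 0ℓ
  IsRoman f = ∀ v → f v ≡ 0F → ∃ λ u → v ~ u × f u ≡ 2F

  IsPerfectRoman : Pred (Labelling G) 0ℓ
  IsPerfectRoman f = ∀ v → f v ≡ 0F → ∃! _≡_ λ u → v ~ u × f u ≡ 2F

  _≼_ : Rel (Labelling G) 0ℓ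
  f ≼ g = ∀ v → f v ≤ g v

  Minimal : Pred (Labelling G) 0ℓ → Pred (Labelling G) 0ℓ
  Minimal P f = P f × ¬ (∃ λ h → P h × ¬ (h ≗ f) × h ≼ f)

  IsMinimalRoman : Pred (Labelling G) 0ℓ
  IsMinimalRoman = Minimal IsRoman

  IsMinimalPerfectRoman : Pred (Labelling G) 0ℓ
  IsMinimalPerfectRoman = Minimal IsPerfectRoman

  -- Two elements are equal when the underlying functions agree pointwise,
  -- whatever the proofs attached to them.
  subset : Pred (Labelling G) 0ℓ → Setoid 0ℓ 0ℓ
  subset P = On.setoid {B = ∃ P} (V →-setoid Fin 3) proj₁

𝓡 : Graph → Setoid 0ℓ 0ℓ
𝓡 G = subset G (IsMinimalRoman G)

𝓟 : Graph → Setoid 0ℓ 0ℓ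
𝓟 G = subset G (IsMinimalPerfectRoman G)

------------------------------------------------------------------------
-- Deterministic multitape Turing machines over an input alphabet A

data Move : Set where
  left stay right : Move

-- The work alphabet consists of the blank (nothing), the letters of A and
-- finitely many auxiliary symbols.
Symbol : Set → ℕ → Set
Symbol A aux = Maybe (A ⊎ Fin aux)

-- A machine halts when its transition function returns nothing.
record TM (A : Set) : Set where
  field
    states : ℕ
    aux    : ℕ
    extra  : ℕ   -- number of tapes besides the first one
    start  : Fin states
    δ      : Fin states → Vec (Symbol A aux) (suc extra) →
             Maybe (Fin states × Vec (Symbol A aux × Move) (suc extra))

-- A two-way infinite tape: the cells left of the head (nearest first), the
-- scanned cell, and the cells right of the head (nearest first).  All cells
-- beyond the ends of the lists are blank.
record Tape (A : Set) (aux : ℕ) : Set where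
  constructor tape
  field
    before : List (Symbol A aux)
    cell   : Symbol A aux
    after  : List (Symbol A aux)

module _ {A : Set} {aux : ℕ} where

  blank : Tape A aux
  blank = tape [] nothing []

  act : Symbol A aux × Move → Tape A aux → Tape A aux
  act (s , stay)  (tape ls       _ rs)       = tape ls s rs
  act (s , left)  (tape []       _ rs)       = tape [] nothing (s ∷ rs)
  act (s , left)  (tape (l ∷ ls) _ rs)       = tape ls l (s ∷ rs)
  act (s , right) (tape ls       _ [])       = tape (s ∷ ls) nothing []
  act (s , right) (tape ls       _ (r ∷ rs)) = tape (s ∷ ls) r rs

  -- A tape holding a word, with the head on its first letter.
  write : List A → Tape A aux
  write []       = blank
  write (x ∷ xs) = tape [] (just (inj₁ x)) (map (λ y → just (inj₁ y)) xs)

  lettersOf : List (Symbol A aux) → List A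
  lettersOf (just (inj₁ x) ∷ ss) = x ∷ lettersOf ss
  lettersOf _                    = []

  -- The word that starts at the head and extends rightwards up to the first
  -- cell not holding a letter of A.
  read : Tape A aux → List A
  read (tape _ s rs) = lettersOf (s ∷ rs)

module _ {A : Set} (M : TM A) where
  open TM M

  record Config : Set where
    constructor config
    field
      state : Fin states
      tapes : Vec (Tape A aux) (suc extra)

  step : Config → Maybe Config
  step (config q ts) with δ q (Vec.map Tape.cell ts)
  ... | nothing       = nothing
  ... | just (q′ , a) = just (config q′ (Vec.zipWith act a ts))

  data _⇓[_]_ : Config → ℕ → Config → Set where
    halt : ∀ {c} → step c ≡ nothing → c ⇓[ 0 ] c
    next : ∀ {c c′ d t} → step c ≡ just c′ → c′ ⇓[ t ] d → c ⇓[ suc t ] d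

  -- The input is given on the first tape, the others being blank; the output
  -- is read off the last tape.
  initial : List A → Config
  initial w = config start (write w Vec.∷ Vec.replicate extra blank)

  output : Config → List A
  output c = read (Vec.last (Config.tapes c))

  Computes : (input result : List A) (steps : ℕ) → Set
  Computes x y t = ∃[ d ] (initial x ⇓[ t ] d × output d ≡ y)

------------------------------------------------------------------------
-- Polynomial-time computability of maps between sets of labellings

data Letter : Set where
  digit : Fin 3 → Letter
  sep   : Letter

encodeLabelling : (G : Graph) → Labelling G → List Letter
encodeLabelling G f = tabulate (λ v → digit (f v))

-- The rows of the adjacency matrix, each followed by a separator.
encodeGraph : Graph → List Letter
encodeGraph G = concat (tabulate λ u → tabulate (λ v → digit (if does (u ~? v) then 1F else 0F)) ++ [ sep ])
  where open Graph G

encode : (G : Graph) → Labelling G → List Letter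
encode G f = encodeLabelling G f ++ [ sep ] ++ encodeGraph G

size : Graph → ℕ
size G = length (encodeGraph G)

-- The polynomial with the given coefficients, constant term first.
⟦_⟧ : List ℕ → ℕ → ℕ
⟦ p ⟧ x = foldr (λ a r → a + x * r) 0 p

-- One machine and one polynomial serve all graphs.  Nothing is required of
-- the machine on words that do not encode an element of the domain.
PolynomialTime : {P Q : (G : Graph) → Pred (Labelling G) 0ℓ} →
                 ((G : Graph) → ∃ (P G) → ∃ (Q G)) → Set₁
PolynomialTime {P} F =
  Σ (TM Letter) λ M → Σ (List ℕ) λ p →
    (G : Graph) (f : ∃ (P G)) →
    ∃[ t ] (t ℕ.≤ ⟦ p ⟧ (size G) ×
            Computes M (encode G (proj₁ f)) (encodeLabelling G (proj₁ (F G f))) t)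

{-# OPTIONS --safe #-}

-- A minimal (perfect) Roman dominating function is determined by the set D of
-- vertices labelled 2, and in both cases D ranges over the same sets: those in
-- which every vertex has a neighbour outside D with no other neighbour in D.
-- Outside D a label depends only on the number of neighbours in D: it is 1 for
-- none, 0 for exactly one, and for two or more it is 0 in the Roman case and 1
-- in the perfect case. Hence both directions of the bijection recompute the
-- labels other than 2 from these numbers, which takes one scan of the
-- labelling for each row of the adjacency matrix.
module Submission where

open import Defs
open import Data.Bool.Base using (Bool; true; false; if_then_else_)
open import Data.Fin.Base using (Fin; zero; suc; inject₁; _≤_)
open import Data.Fin.Patterns
open import Data.Fin.Properties using (_≟_; any?; suc-injective; 0≢1+n)
open import Data.List.Base using (List; []; _∷_; _++_; _ʳ++_; [_]; concat; length; map; tabulate)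
open import Data.List.Properties using (map-++; ++-assoc; map-tabulate; length-++; length-tabulate)
open import Data.Maybe.Base using (Maybe; just; nothing)
open import Data.Nat.Base as ℕ using (ℕ; zero; suc; _+_; _*_; z≤n; s≤s)
import Data.Nat.Properties as ℕ
open import Data.Nat.Tactic.RingSolver using (solve-∀)
open import Data.Product.Base using (Σ; ∃; ∃₂; _×_; _,_; proj₁)
open import Data.Product using (∃!)
open import Data.Sum.Base using (inj₁)
open import Data.Vec.Base as Vec using (Vec; []; _∷_)
open import Data.Vec.Functional using (updateAt)
open import Data.Vec.Functional.Properties using (updateAt-updates; updateAt-minimal)
open import Function.Base using (_∘_; const)
open import Function.Bundles using (Bijection; _⇔_; mk⇔; Equivalence)
open import Level using (0ℓ)
open import Relation.Binary.PropositionalEquality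
  using (_≡_; _≢_; _≗_; refl; sym; trans; cong; cong₂; subst; module ≡-Reasoning)
open import Relation.Nullary using (¬_; yes; no; does; contradiction; _×-dec_; ¬?)
open import Relation.Nullary.Decidable using (decidable-stable; dec-false; does-⇔)
open import Relation.Unary using (Pred)

-- Counting up to two

-- Saturation at 2 keeps the counter finite, so that the machine can hold it in its state.
bump : Fin 3 → Bool → Fin 3
bump c  false = c
bump 0F true  = 1F
bump 1F true  = 2F
bump 2F true  = 2F

tally : ∀ {m} → Fin 3 → (Fin m → Bool) → Fin 3
tally {zero}  c p = c
tally {suc m} c p = tally (bump c (p 0F)) (p ∘ suc)

bump-comm : ∀ c a b → bump (bump c a) b ≡ bump (bump c b) a
bump-comm c  false b     = refl
bump-comm c  true  false = refl
bump-comm c  true  true  = refl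

-- Needed because `tally` treats `0F` first, while the induction through `count-suc` adds it last.
tally-bump : ∀ {m} c b (p : Fin m → Bool) → tally (bump c b) p ≡ bump (tally c p) b
tally-bump {zero}  c b p = refl
tally-bump {suc m} c b p = trans (cong (λ a → tally a (p ∘ suc)) (bump-comm c b (p 0F)))
                                 (tally-bump (bump c (p 0F)) b (p ∘ suc))

tally-cong : ∀ {m} c {p q : Fin m → Bool} → p ≗ q → tally c p ≡ tally c q
tally-cong {zero}  c     p≗q = refl
tally-cong {suc m} c {q = q} p≗q rewrite p≗q 0F = tally-cong (bump c (q 0F)) (p≗q ∘ suc)

-- The three cases match the notions of domination: `one` is the unique existence asked for in the
-- perfect case, and `many` carries two witnesses that refute it.
data Count {m} (P : Pred (Fin m) 0ℓ) : Fin 3 → Set where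
  none : (∀ u → ¬ P u) → Count P 0F
  one  : ∃! _≡_ P → Count P 1F
  many : (∃₂ λ u w → u ≢ w × P u × P w) → Count P 2F

count-map : ∀ {m} {P Q : Pred (Fin m) 0ℓ} {c} → (∀ u → P u ⇔ Q u) → Count P c → Count Q c
count-map P⇔Q (none ¬p) = none λ u → ¬p u ∘ Equivalence.from (P⇔Q u)
count-map P⇔Q (one (u , pu , unique)) =
  one (u , Equivalence.to (P⇔Q u) pu , unique ∘ Equivalence.from (P⇔Q _))
count-map P⇔Q (many (u , w , u≢w , pu , pw)) =
  many (u , w , u≢w , Equivalence.to (P⇔Q u) pu , Equivalence.to (P⇔Q w) pw)

count-suc : ∀ {m} (p : Fin (suc m) → Bool) {c} →
            Count (λ u → p (suc u) ≡ true) c → Count (λ u → p u ≡ true) (bump c (p 0F))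
count-suc p cnt with p 0F in eq
count-suc p (none ¬p) | true = one (0F , eq , unique)
  where
  unique : ∀ {u} → p u ≡ true → 0F ≡ u
  unique {zero}  _  = refl
  unique {suc u} pu = contradiction pu (¬p u)
count-suc p (one (u , pu , _)) | true = many (0F , suc u , 0≢1+n , eq , pu)
count-suc p (many (u , w , u≢w , pu , pw)) | true =
  many (suc u , suc w , u≢w ∘ suc-injective , pu , pw)
count-suc p (none ¬p) | false = none λ where
  zero    p0 → contradiction (trans (sym eq) p0) λ ()
  (suc u) pu → ¬p u pu
count-suc p (one (u , pu , unique)) | false = one (suc u , pu , unique′)
  where
  unique′ : ∀ {w} → p w ≡ true → suc u ≡ w
  unique′ {zero}  p0 = contradiction (trans (sym eq) p0) λ ()
  unique′ {suc w} pw = cong suc (unique pw)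
count-suc p (many (u , w , u≢w , pu , pw)) | false =
  many (suc u , suc w , u≢w ∘ suc-injective , pu , pw)

tally-count : ∀ {m} (p : Fin m → Bool) → Count (λ u → p u ≡ true) (tally 0F p)
tally-count {zero}  p = none λ ()
tally-count {suc m} p = subst (Count _) (sym (tally-bump 0F (p 0F) (p ∘ suc)))
                              (count-suc p (tally-count (p ∘ suc)))

-- Relabelling

-- The first argument is a matrix entry in the form of a tape digit, hence in `Fin 3`; the digit 2
-- does not occur in an adjacency matrix.
hit : Fin 3 → Fin 3 → Bool
hit 1F x = does (x ≟ 2F)
hit _  _ = false

-- The parameter `k` is the label for two or more neighbours labelled 2, the only point where the
-- two notions differ.
settle : Fin 2 → Fin 3 → Fin 3
settle k 0F = 1F
settle k 1F = 0F
settle k 2F = inject₁ k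

choose : Fin 2 → Fin 3 → Fin 3 → Fin 3
choose k 2F c = 2F
choose k _  c = settle k c

≡0⇒≢2 : ∀ {x : Fin 3} → x ≡ 0F → x ≢ 2F
≡0⇒≢2 refl ()

settle≢2 : ∀ k c → settle k c ≢ 2F
settle≢2 k  0F ()
settle≢2 k  1F ()
settle≢2 0F 2F ()
settle≢2 1F 2F ()

choose-≢2 : ∀ k {x} c → x ≢ 2F → choose k x c ≡ settle k c
choose-≢2 k {0F} c x≢2 = refl
choose-≢2 k {1F} c x≢2 = refl
choose-≢2 k {2F} c x≢2 = contradiction refl x≢2

choose-2 : ∀ k x c → choose k x c ≡ 2F ⇔ x ≡ 2F
choose-2 k 0F c = mk⇔ (λ eq → contradiction eq (settle≢2 k c)) λ ()
choose-2 k 1F c = mk⇔ (λ eq → contradiction eq (settle≢2 k c)) λ ()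
choose-2 k 2F c = mk⇔ (const refl) (const refl)

-- Labels other than 2 are recomputed from the count alone, so the inner choice leaves no trace.
-- This makes the two relabellings mutually inverse.
choose-choose : ∀ j k x c → choose j (choose k x c) c ≡ choose j x c
choose-choose j k 2F c = refl
choose-choose j k 0F c = choose-≢2 j c (settle≢2 k c)
choose-choose j k 1F c = choose-≢2 j c (settle≢2 k c)

hit-cong : ∀ e {x y} → x ≡ 2F ⇔ y ≡ 2F → hit e x ≡ hit e y
hit-cong 0F         x⇔y = refl
hit-cong 1F {x} {y} x⇔y = does-⇔ x⇔y (x ≟ 2F) (y ≟ 2F)
hit-cong 2F         x⇔y = refl

module _ (G : Graph) where
  open Graph G using (V; order; _~_; _~?_)

  adjacency : V → V → Fin 3
  adjacency u v = if does (u ~? v) then 1F else 0F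

  hit-adjacency : ∀ v u x → hit (adjacency v u) x ≡ true ⇔ (v ~ u × x ≡ 2F)
  hit-adjacency v u x with v ~? u
  hit-adjacency v u 0F | yes v~u = mk⇔ (λ ()) λ ()
  hit-adjacency v u 1F | yes v~u = mk⇔ (λ ()) λ ()
  hit-adjacency v u 2F | yes v~u = mk⇔ (λ _ → v~u , refl) (const refl)
  ...                  | no  v≁u = mk⇔ (λ ()) λ (v~u , _) → contradiction v~u v≁u

  hits : Labelling G → V → Fin 3
  hits f v = tally 0F (λ u → hit (adjacency v u) (f u))

  hits-count : ∀ f v → Count (λ u → v ~ u × f u ≡ 2F) (hits f v)
  hits-count f v = count-map (λ u → hit-adjacency v u (f u)) (tally-count _)

  hits-cong : ∀ {f g} → (∀ u → f u ≡ 2F ⇔ g u ≡ 2F) → hits f ≗ hits g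
  hits-cong f⇔g v = tally-cong 0F (λ u → hit-cong (adjacency v u) (f⇔g u))

  relabel : Fin 2 → Labelling G → Labelling G
  relabel k f v = choose k (f v) (hits f v)

  hits-relabel : ∀ k f → hits (relabel k f) ≗ hits f
  hits-relabel k f = hits-cong (λ u → choose-2 k (f u) (hits f u))

  relabel-cong : ∀ k {f g} → f ≗ g → relabel k f ≗ relabel k g
  relabel-cong k f≗g v =
    cong₂ (choose k) (f≗g v)
      (hits-cong (λ u → mk⇔ (trans (sym (f≗g u))) (trans (f≗g u))) v)

  relabel-relabel : ∀ j k f → relabel j (relabel k f) ≗ relabel j f
  relabel-relabel j k f v = trans (cong (choose j (relabel k f v)) (hits-relabel k f v))
                                  (choose-choose j k (f v) (hits f v))

  -- Roman domination is the case k = 0 and perfect Roman domination k = 1.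
  Dominating : Fin 2 → Pred (Labelling G) 0ℓ
  Dominating k f = ∀ v → f v ≡ 0F → settle k (hits f v) ≡ 0F

  -- For `k` = 0, `settle` gives 0 exactly on the counts one and many, which together mean
  -- existence.
  IsRoman⇔Dominating : ∀ {f} → IsRoman G f ⇔ Dominating 0F f
  IsRoman⇔Dominating {f} = mk⇔
    (λ roman v fv≡0 → to (hits-count f v) (roman v fv≡0))
    (λ dom v fv≡0 → from (hits-count f v) (dom v fv≡0))
    where
    to : ∀ {c} {P : Pred V 0ℓ} → Count P c → ∃ P → settle 0F c ≡ 0F
    to (none ¬p) (u , pu) = contradiction pu (¬p u)
    to (one _)   _        = refl
    to (many _)  _        = refl

    from : ∀ {c} {P : Pred V 0ℓ} → Count P c → settle 0F c ≡ 0F → ∃ P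
    from (one (u , pu , _))          _ = u , pu
    from (many (u , _ , _ , pu , _)) _ = u , pu

  -- For `k` = 1, `settle` gives 0 on the count one only.
  IsPerfectRoman⇔Dominating : ∀ {f} → IsPerfectRoman G f ⇔ Dominating 1F f
  IsPerfectRoman⇔Dominating {f} = mk⇔
    (λ roman v fv≡0 → to (hits-count f v) (roman v fv≡0))
    (λ dom v fv≡0 → from (hits-count f v) (dom v fv≡0))
    where
    to : ∀ {c} {P : Pred V 0ℓ} → Count P c → ∃! _≡_ P → settle 1F c ≡ 0F
    to (none ¬p) (u , pu , _) = contradiction pu (¬p u)
    to (one _)   _            = refl
    to (many (u , w , u≢w , pu , pw)) (_ , _ , unique) =
      contradiction (trans (sym (unique pu)) (unique pw)) u≢w

    from : ∀ {c} {P : Pred V 0ℓ} → Count P c → settle 1F c ≡ 0F → ∃! _≡_ P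
    from (one ∃!p) _ = ∃!p

  Minimal-map : ∀ {P Q : Pred (Labelling G) 0ℓ} → (∀ {f} → P f ⇔ Q f) →
                ∀ {f} → Minimal G P f → Minimal G Q f
  Minimal-map P⇔Q (pf , min) =
    Equivalence.to P⇔Q pf , λ (h , qh , h≢f , h≼f) → min (h , Equivalence.from P⇔Q qh , h≢f , h≼f)

  -- Minimality is a negated existential; decidable equality of labels turns it into pointwise
  -- equality.
  minimal-≗ : ∀ {P : Pred (Labelling G) 0ℓ} {f} → Minimal G P f →
              ∀ {h} → P h → _≼_ G h f → h ≗ f
  minimal-≗ {f = f} (_ , min) {h} ph h≼f v =
    decidable-stable (h v ≟ f v) λ hv≢fv → min (h , ph , (λ h≗f → hv≢fv (h≗f v)) , h≼f)

  -- Minimality through private neighbours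

  PrivateNeighbour : Labelling G → V → V → Set
  PrivateNeighbour f v w = w ~ v × f w ≢ 2F × hits f w ≡ 1F

  -- Only the first component depends on `k`; the second concerns just the set of vertices labelled
  -- 2, where the count 1 makes `v` the sole neighbour of `w` in that set.
  Canonical : Fin 2 → Pred (Labelling G) 0ℓ
  Canonical k f = relabel k f ≗ f × (∀ v → f v ≡ 2F → ∃ (PrivateNeighbour f v))

  relabel-canonical : ∀ {j} k {f} → Canonical j f → Canonical k (relabel k f)
  relabel-canonical k {f} (_ , private′) =
    relabel-relabel k k f ,
    λ v eq → let w , w~v , fw≢2 , hw≡1 = private′ v (Equivalence.to (choose-2 k (f v) (hits f v)) eq)
             in w , w~v , fw≢2 ∘ Equivalence.to (choose-2 k (f w) (hits f w)) ,
                trans (hits-relabel k f w) hw≡1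

  hits-pos : ∀ k {f v} → settle k (hits f v) ≡ 0F → ∃ λ u → v ~ u × f u ≡ 2F
  hits-pos k {f} {v} eq with hits f v | hits-count f v
  ... | _ | one  (u , pu , _)         = u , pu
  ... | _ | many (u , _ , _ , pu , _) = u , pu

  hits-unique : ∀ {f v} → hits f v ≡ 1F → ∀ {u w} → v ~ u × f u ≡ 2F → v ~ w × f w ≡ 2F → u ≡ w
  hits-unique {f} {v} eq pu pw with hits f v | hits-count f v
  ... | _ | one (_ , _ , unique) = trans (sym (unique pu)) (unique pw)

  ≤-2 : ∀ {x y : Fin 3} → x ≤ y → x ≡ 2F → y ≡ 2F
  ≤-2 {y = 2F} x≤y refl = refl
  ≤-2 {y = 1F} (s≤s ()) refl

  ≤-0 : ∀ {x y : Fin 3} → x ≤ y → y ≡ 0F → x ≡ 0F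
  ≤-0 {0F} x≤y refl = refl

  canonical⇒minimal : ∀ k {f} → Canonical k f → Minimal G (Dominating k) f
  canonical⇒minimal k {f} (fixed , private′) =
    dominating , λ (h , dom , h≢f , h≼f) → h≢f (unique h dom h≼f)
    where
    settled : ∀ {v} → f v ≢ 2F → settle k (hits f v) ≡ f v
    settled {v} fv≢2 = trans (sym (choose-≢2 k (hits f v) fv≢2)) (fixed v)

    dominating : Dominating k f
    dominating v fv≡0 =
      trans (settled (≡0⇒≢2 fv≡0)) fv≡0

    module _ h (dom : Dominating k h) (h≼f : _≼_ G h f) where
      -- The private neighbour `w` of `v` is labelled 0 by `f`, hence by `h`. So `w` has a neighbour
      -- labelled 2 by `h`, hence by `f`, and this can only be `v`.
      twos : ∀ v → f v ≡ 2F → h v ≡ 2F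
      twos v fv≡2 with private′ v fv≡2
      ... | w , w~v , fw≢2 , hw≡1
        with hits-pos k (dom w (≤-0 (h≼f w) (trans (sym (settled fw≢2)) (cong (settle k) hw≡1))))
      ... | u , w~u , hu≡2 =
        subst (λ z → h z ≡ 2F) (hits-unique hw≡1 (w~u , ≤-2 (h≼f u) hu≡2) (w~v , fv≡2)) hu≡2

      same-hits : hits h ≗ hits f
      same-hits = hits-cong λ u → mk⇔ (≤-2 (h≼f u)) (twos u)

      unique : h ≗ f
      unique v with f v in fv | h v in hv | h≼f v
      ... | 2F | _  | _ = trans (sym hv) (twos v fv)
      ... | 0F | 0F | _ = refl
      ... | 1F | 1F | _ = refl
      ... | 1F | 2F | s≤s ()
      -- The counts agree, yet `settle` would have to give 0 because `h` is dominating and 1 because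
      -- `f` is fixed by relabelling.
      ... | 1F | 0F | _ = begin
        0F                    ≡⟨ dom v hv ⟨
        settle k (hits h v)   ≡⟨ cong (settle k) (same-hits v) ⟩
        settle k (hits f v)   ≡⟨ settled (λ fv≡2 → contradiction (trans (sym fv) fv≡2) λ ()) ⟩
        f v                   ≡⟨ fv ⟩
        1F                    ∎
        where open ≡-Reasoning

  -- Domination keeps each 0 at 0, and `settle` never exceeds 1.
  relabel-≼ : ∀ k {f} → Dominating k f → _≼_ G (relabel k f) f
  relabel-≼ k {f} dom v with f v | dom v
  ... | 0F | d rewrite d refl = z≤n
  ... | 2F | _ = ℕ.≤-refl
  ... | 1F | _ = ≢2⇒≤1 (settle≢2 k (hits f v))
    where
    ≢2⇒≤1 : ∀ {x : Fin 3} → x ≢ 2F → _≤_ {3} {3} x 1F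
    ≢2⇒≤1 {0F} x≢2 = z≤n
    ≢2⇒≤1 {1F} x≢2 = s≤s z≤n
    ≢2⇒≤1 {2F} x≢2 = contradiction refl x≢2

  relabel-dominating : ∀ k f → Dominating k (relabel k f)
  relabel-dominating k f v eq = trans (cong (settle k) (hits-relabel k f v)) (drop (f v) eq)
    where
    drop : ∀ x {c} → choose k x c ≡ 0F → settle k c ≡ 0F
    drop 0F eq = eq
    drop 1F eq = eq
    drop 2F ()

  -- A vertex labelled 2 without private neighbour could be relabelled 1.
  module _ (k : Fin 2) {f : Labelling G} (dom : Dominating k f)
           {v : V} (fv≡2 : f v ≡ 2F) (¬private : ¬ ∃ (PrivateNeighbour f v)) where

    lower : Labelling G
    lower = updateAt f v (const 1F)

    lower-v : lower v ≡ 1F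
    lower-v = updateAt-updates v f

    lower-≢ : ∀ {u} → u ≢ v → lower u ≡ f u
    lower-≢ {u} u≢v = updateAt-minimal u v f u≢v

    lower-≼ : _≼_ G lower f
    lower-≼ u with u ≟ v
    ... | yes refl rewrite lower-v | fv≡2 = s≤s z≤n
    ... | no  u≢v rewrite lower-≢ u≢v = ℕ.≤-refl

    hits-lower : ∀ {w} → ¬ w ~ v → hits lower w ≡ hits f w
    hits-lower {w} w≁v = tally-cong 0F same
      where
      same : ∀ u → hit (adjacency w u) (lower u) ≡ hit (adjacency w u) (f u)
      same u with u ≟ v
      ... | no  u≢v = cong (hit (adjacency w u)) (lower-≢ u≢v)
      ... | yes refl rewrite dec-false (w ~? u) w≁v = refl

    -- The hypothesis on `k` expresses the Roman case, where any positive count allows the label 0.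
    settle-pos : settle k 2F ≡ 0F → ∀ {h w u} → w ~ u × h u ≡ 2F → settle k (hits h w) ≡ 0F
    settle-pos eq {h} {w} pu with hits h w | hits-count h w
    ... | _ | none ¬p = contradiction pu (¬p _)
    ... | _ | one _   = refl
    ... | _ | many _  = eq

    lower-dominating : Dominating k lower
    lower-dominating w lw≡0 with w ≟ v
    ... | yes refl = contradiction (trans (sym lower-v) lw≡0) λ ()
    ... | no  w≢v with w ~? v | trans (sym (lower-≢ w≢v)) lw≡0
    ...   | no  w≁v | fw≡0 = trans (cong (settle k) (hits-lower w≁v)) (dom w fw≡0)
    ...   | yes w~v | fw≡0 with hits f w in hw | hits-count f w | dom w fw≡0
    ...     | _ | one _ | _ = contradiction (w , w~v , ≡0⇒≢2 fw≡0 , hw) ¬private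
    -- Of two distinct neighbours labelled 2, at least one is not `v` and keeps its label.
    ...     | _ | many (u , u′ , u≢u′ , (w~u , fu≡2) , (w~u′ , fu′≡2)) | eq with u ≟ v
    ...       | no  u≢v  = settle-pos eq (w~u , trans (lower-≢ u≢v) fu≡2)
    ...       | yes refl = settle-pos eq (w~u′ , trans (lower-≢ (u≢u′ ∘ sym)) fu′≡2)

  -- Both `relabel k f` and `lower` would be dominating and below `f`, hence equal to `f`; but
  -- `lower` differs from `f` at `v`, so private neighbours exist.
  minimal⇒canonical : ∀ k {f} → Minimal G (Dominating k) f → Canonical k f
  minimal⇒canonical k {f} min@(dom , _) =
    minimal-≗ min (relabel-dominating k f) (relabel-≼ k dom) , private′
    where
    private′ : ∀ v → f v ≡ 2F → ∃ (PrivateNeighbour f v)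
    private′ v fv≡2 with any? (λ w → (w ~? v) ×-dec ¬? (f w ≟ 2F) ×-dec (hits f w ≟ 1F))
    ... | yes p = p
    ... | no ¬p = contradiction
      (trans (sym (lower-v k dom fv≡2 ¬p))
             (trans (minimal-≗ min (lower-dominating k dom fv≡2 ¬p) (lower-≼ k dom fv≡2 ¬p) v) fv≡2))
      λ ()

  IsMinimalRoman⇔Canonical : ∀ {f} → IsMinimalRoman G f ⇔ Canonical 0F f
  IsMinimalRoman⇔Canonical = mk⇔
    (minimal⇒canonical 0F ∘ Minimal-map IsRoman⇔Dominating)
    (Minimal-map (mk⇔ (Equivalence.from IsRoman⇔Dominating) (Equivalence.to IsRoman⇔Dominating))
      ∘ canonical⇒minimal 0F)

  IsMinimalPerfectRoman⇔Canonical : ∀ {f} → IsMinimalPerfectRoman G f ⇔ Canonical 1F f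
  IsMinimalPerfectRoman⇔Canonical = mk⇔
    (minimal⇒canonical 1F ∘ Minimal-map IsPerfectRoman⇔Dominating)
    (Minimal-map (mk⇔ (Equivalence.from IsPerfectRoman⇔Dominating) (Equivalence.to IsPerfectRoman⇔Dominating))
      ∘ canonical⇒minimal 1F)

  -- The bijection

  bijection : Bijection (𝓡 G) (𝓟 G)
  bijection = record
    { to        = λ (f , min) → relabel 1F f ,
        Equivalence.from IsMinimalPerfectRoman⇔Canonical
          (relabel-canonical 1F (Equivalence.to IsMinimalRoman⇔Canonical min))
    ; cong      = relabel-cong 1F
    ; bijective = (λ {x} {y} → injective {x} {y}) , λ (g , min) →
        let can = Equivalence.to IsMinimalPerfectRoman⇔Canonical min in
        -- This witness is the value of `Bijection.to⁻`, so the inverse is again a relabelling that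
        -- the machine can compute.
        (relabel 0F g , Equivalence.from IsMinimalRoman⇔Canonical (relabel-canonical 0F can)) ,
        λ z≗ v → trans (relabel-cong 1F z≗ v) (trans (relabel-relabel 1F 0F g v) (proj₁ can v))
    }
    where
    injective : ∀ {x y : ∃ (IsMinimalRoman G)} →
                relabel 1F (proj₁ x) ≗ relabel 1F (proj₁ y) → proj₁ x ≗ proj₁ y
    injective {f , fmin} {g , gmin} eq v = begin
      f v                          ≡⟨ proj₁ (Equivalence.to IsMinimalRoman⇔Canonical fmin) v ⟨
      relabel 0F f v               ≡⟨ relabel-relabel 0F 1F f v ⟨
      relabel 0F (relabel 1F f) v  ≡⟨ relabel-cong 0F eq v ⟩
      relabel 0F (relabel 1F g) v  ≡⟨ relabel-relabel 0F 1F g v ⟩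
      relabel 0F g v               ≡⟨ proj₁ (Equivalence.to IsMinimalRoman⇔Canonical gmin) v ⟩
      g v                          ∎
      where open ≡-Reasoning

-- Tapes

pattern ▢ = nothing
pattern letter x = just (inj₁ x)
pattern digit′ x = letter (digit x)

Sym : Set
Sym = Symbol Letter 0

symbols : List Letter → List Sym
symbols = map (λ x → letter x)

word : ∀ {m} → (Fin m → Fin 3) → List Sym
word d = tabulate (λ v → digit′ (d v))

-- With `load` the head is on the first symbol of the right part, with `unload` on the nearest
-- symbol of the left part; both supply a blank at the end, which gives each move a uniform
-- equation.
load : List Sym → List Sym → Tape Letter 0
load ls []       = tape ls ▢ []
load ls (r ∷ rs) = tape ls r rs

unload : List Sym → List Sym → Tape Letter 0
unload []       rs = tape [] ▢ rs
unload (l ∷ ls) rs = tape ls l rs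

act-right : ∀ {s ls c} rs → act (s , right) (tape ls c rs) ≡ load (s ∷ ls) rs
act-right []       = refl
act-right (r ∷ rs) = refl

act-left : ∀ {s c rs} ls → act (s , left) (tape ls c rs) ≡ unload ls (s ∷ rs)
act-left []       = refl
act-left (l ∷ ls) = refl

write-load : ∀ w → write w ≡ load [] (symbols w)
write-load []      = refl
write-load (x ∷ w) = refl

lettersOf-word : ∀ {m} (d : Fin m → Fin 3) → lettersOf (word d ++ [ ▢ ]) ≡ tabulate (digit ∘ d)
lettersOf-word {zero}  d = refl
lettersOf-word {suc m} d = cong (digit (d 0F) ∷_) (lettersOf-word (d ∘ suc))

read-load : ∀ ls rs → read (load ls rs) ≡ lettersOf rs
read-load ls []       = refl
read-load ls (r ∷ rs) = refl

-- The number of rows is independent of their length, since the induction removes rows but keeps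
-- their length.
rows : ∀ {m n} → (Fin m → Fin n → Fin 3) → List Sym
rows {zero}  e = []
rows {suc m} e = word (e 0F) ++ letter sep ∷ rows (e ∘ suc)

symbols-tabulate : ∀ {m} (d : Fin m → Fin 3) → symbols (tabulate (digit ∘ d)) ≡ word d
symbols-tabulate d = map-tabulate (digit ∘ d) _

encodeRows : ∀ {m n} → (Fin m → Fin n → Fin 3) → List Letter
encodeRows e = concat (tabulate λ u → tabulate (digit ∘ e u) ++ [ sep ])

symbols-encodeRows : ∀ {m n} (e : Fin m → Fin n → Fin 3) → symbols (encodeRows e) ≡ rows e
symbols-encodeRows {zero}  e = refl
symbols-encodeRows {suc m} e = begin
  symbols ((row ++ [ sep ]) ++ rest)         ≡⟨ cong symbols (++-assoc row [ sep ] rest) ⟩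
  symbols (row ++ sep ∷ rest)                ≡⟨ map-++ _ row (sep ∷ rest) ⟩
  symbols row ++ letter sep ∷ symbols rest   ≡⟨ cong₂ (λ a b → a ++ letter sep ∷ b)
                                                  (symbols-tabulate (e 0F)) (symbols-encodeRows (e ∘ suc)) ⟩
  word (e 0F) ++ letter sep ∷ rows (e ∘ suc) ∎
  where
  open ≡-Reasoning
  row rest : List Letter
  row  = tabulate (digit ∘ e 0F)
  rest = encodeRows (e ∘ suc)

length-encodeRows : ∀ {m n} (e : Fin m → Fin n → Fin 3) → length (encodeRows e) ≡ m * suc n
length-encodeRows {zero}      e = refl
length-encodeRows {suc m} {n} e
  rewrite length-++ (tabulate (digit ∘ e 0F) ++ [ sep ]) {encodeRows (e ∘ suc)}
        | length-++ (tabulate (digit ∘ e 0F)) {[ sep ]}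
        | length-tabulate (digit ∘ e 0F)
        | ℕ.+-comm n 1
        = cong (suc n +_) (length-encodeRows (e ∘ suc))

-- The machine

pattern starting        = 0F
pattern copying         = 1F
pattern rewindingCopies = 2F
pattern rewindingCopy   = 3F
pattern rewindingOutput = 4F
pattern halted          = 5F
pattern counting c      = suc (suc (suc (suc (suc (suc c)))))

-- The first tape holds the input and the two others copies of the labelling.
-- The copy on the second tape is scanned alongside each row of the adjacency
-- matrix; the one on the third is overwritten with the result, one label after
-- each row.
transition : Fin 2 → Fin 9 → Vec Sym 3 → Maybe (Fin 9 × Vec (Sym × Move) 3)
-- The blank left behind on the second and third tapes marks where rewinding stops.
transition k starting (a ∷ b ∷ c ∷ []) =
  just (copying , (a , stay) ∷ (b , right) ∷ (c , right) ∷ [])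
transition k copying (digit′ x ∷ b ∷ c ∷ []) =
  just (copying , (digit′ x , right) ∷ (digit′ x , right) ∷ (digit′ x , right) ∷ [])
transition k copying (a ∷ b ∷ c ∷ []) =
  just (rewindingCopies , (a , right) ∷ (▢ , left) ∷ (▢ , left) ∷ [])
transition k rewindingCopies (a ∷ just b ∷ c ∷ []) =
  just (rewindingCopies , (a , stay) ∷ (just b , left) ∷ (c , left) ∷ [])
transition k rewindingCopies (a ∷ ▢ ∷ c ∷ []) =
  just (counting 0F , (a , stay) ∷ (▢ , right) ∷ (c , right) ∷ [])
transition k (counting c) (digit′ x ∷ digit′ y ∷ o ∷ []) =
  just (counting (bump c (hit x y)) , (digit′ x , right) ∷ (digit′ y , right) ∷ (o , stay) ∷ [])
-- At the end of a row the third head is on the vertex of that row, whose old label `y` and count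
-- `c` give the new label.
transition k (counting c) (letter sep ∷ b ∷ digit′ y ∷ []) =
  just (rewindingCopy , (letter sep , right) ∷ (▢ , left) ∷ (digit′ (choose k y c) , right) ∷ [])
transition k (counting c) (▢ ∷ b ∷ o ∷ []) =
  just (rewindingOutput , (▢ , stay) ∷ (b , stay) ∷ (▢ , left) ∷ [])
transition k rewindingCopy (a ∷ just b ∷ o ∷ []) =
  just (rewindingCopy , (a , stay) ∷ (just b , left) ∷ (o , stay) ∷ [])
transition k rewindingCopy (a ∷ ▢ ∷ o ∷ []) =
  just (counting 0F , (a , stay) ∷ (▢ , right) ∷ (o , stay) ∷ [])
transition k rewindingOutput (a ∷ b ∷ just o ∷ []) =
  just (rewindingOutput , (a , stay) ∷ (b , stay) ∷ (just o , left) ∷ [])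
transition k rewindingOutput (a ∷ b ∷ ▢ ∷ []) =
  just (halted , (a , stay) ∷ (b , stay) ∷ (▢ , right) ∷ [])
transition _ _ _ = nothing

-- Runs of the machine and their length

module _ (k : Fin 2) where

  machine : TM Letter
  machine = record { states = 9 ; aux = 0 ; extra = 2 ; start = starting ; δ = transition k }

  ⟪_∣_,_,_⟫ : Fin 9 → (a b c : Tape Letter 0) → Config machine
  ⟪ q ∣ a , b , c ⟫ = config q (a ∷ b ∷ c ∷ [])

  _↝[_]_ : Config machine → ℕ → List Letter → Set
  c ↝[ t ] w = ∃ λ d → _⇓[_]_ machine c t d × output machine d ≡ w

  run : ∀ {c c′ t w} → step machine c ≡ just c′ → c′ ↝[ t ] w → c ↝[ suc t ] w
  run eq (d , c⇓d , out) = d , next eq c⇓d , out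

  retime : ∀ {c t t′ w} → t ≡ t′ → c ↝[ t ] w → c ↝[ t′ ] w
  retime refl r = r

  -- The context `C` lets one lemma serve the second tape, the third tape and both at once.
  rewind : (C : Tape Letter 0 → Config machine) →
           (∀ {x ls rs} → step machine (C (tape ls (letter x) rs)) ≡
                          just (C (act (letter x , left) (tape ls (letter x) rs)))) →
           ∀ {m} (d : Fin m → Fin 3) {ls rs t w} →
           C (unload ls (word d ++ rs)) ↝[ t ] w →
           C (unload (word d ʳ++ ls) rs) ↝[ m + t ] w
  rewind C eq {zero}  d r = r
  rewind C eq {suc m} d {ls} {t = t} r =
    retime (ℕ.+-suc m t)
      (rewind C eq (d ∘ suc) (run (trans eq (cong (just ∘ C) (act-left ls))) r))

  -- The continuation is assumed for every `ls₀`: the first head never moves left, so what lies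
  -- behind it need not be described.
  copy : ∀ {m} (f : Fin m → Fin 3) {ls₀ ls rest t w} →
         (∀ {ls₀} → ⟪ copying ∣ load ls₀ rest , tape (word f ʳ++ ls) ▢ []
                    , tape (word f ʳ++ ls) ▢ [] ⟫ ↝[ t ] w) →
         ⟪ copying ∣ load ls₀ (word f ++ rest) , tape ls ▢ [] , tape ls ▢ [] ⟫ ↝[ m + t ] w
  copy {zero}  f r = r
  copy {suc m} f {rest = rest} r =
    run (cong (λ a → just ⟪ copying ∣ a , _ , _ ⟫) (act-right (word (f ∘ suc) ++ rest)))
        (copy (f ∘ suc) r)

  scan : ∀ {m} c (e d : Fin m → Fin 3) {ls₀ ls₁ rest out t w} →
         (∀ {ls₀} → ⟪ counting (tally c (λ u → hit (e u) (d u)))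
                    ∣ load ls₀ rest , tape (word d ʳ++ ls₁) ▢ [] , out ⟫ ↝[ t ] w) →
         ⟪ counting c ∣ load ls₀ (word e ++ rest) , load ls₁ (word d ++ [ ▢ ]) , out ⟫ ↝[ m + t ] w
  scan {zero}  c e d r = r
  scan {suc m} c e d {rest = rest} r =
    run (cong₂ (λ a b → just ⟪ counting (bump c (hit (e 0F) (d 0F))) ∣ a , b , _ ⟫)
               (act-right (word (e ∘ suc) ++ rest)) (act-right (word (d ∘ suc) ++ [ ▢ ])))
        (scan _ (e ∘ suc) (d ∘ suc) r)

  relabelRows : ∀ {m n} → (Fin m → Fin n → Fin 3) → (Fin n → Fin 3) → (Fin m → Fin 3) → Fin m → Fin 3
  relabelRows e f d u = choose k (d u) (tally 0F (λ v → hit (e u v) (f v)))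

  -- Here `f` is the intact copy used for counting and `d` the part of the third tape not yet
  -- overwritten. A row costs `n` steps to scan, one to write, `n` to rewind and one to leave the
  -- blank.
  scanRows : ∀ {m n} (e : Fin m → Fin n → Fin 3) (f : Fin n → Fin 3) (d : Fin m → Fin 3)
             {ls₀ ls₂ t w} →
             (∀ {ls₀} → ⟪ counting 0F ∣ tape ls₀ ▢ [] , load [ ▢ ] (word f ++ [ ▢ ])
                        , tape (word (relabelRows e f d) ʳ++ ls₂) ▢ [] ⟫ ↝[ t ] w) →
             ⟪ counting 0F ∣ load ls₀ (rows e) , load [ ▢ ] (word f ++ [ ▢ ])
             , load ls₂ (word d ++ [ ▢ ]) ⟫ ↝[ m * (n + suc (n + 1)) + t ] w
  scanRows {zero}          e f d         r = r
  scanRows {suc m} {n} e f d {ls₂ = ls₂} {t} r =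
    retime (time n (m * (n + suc (n + 1))) t)
      (scan 0F (e 0F) f {rest = letter sep ∷ rows (e ∘ suc)} (λ {ls} →
        let a = load (letter sep ∷ ls) (rows (e ∘ suc))
            o = load (digit′ (relabelRows e f d 0F) ∷ ls₂) (word (d ∘ suc) ++ [ ▢ ])
        in
        run (cong₂ (λ (a , b) o → just ⟪ rewindingCopy ∣ a , b , o ⟫)
               (cong₂ _,_ (act-right (rows (e ∘ suc))) (act-left (word f ʳ++ [ ▢ ])))
               (act-right (word (d ∘ suc) ++ [ ▢ ])))
        (rewind (λ b → ⟪ rewindingCopy ∣ a , b , o ⟫) refl f
        (run (cong (λ b → just ⟪ counting 0F ∣ a , b , o ⟫) (act-right (word f ++ [ ▢ ])))
        (scanRows (e ∘ suc) f (d ∘ suc) r)))))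
    where
    time : ∀ n p t → n + suc (n + suc (p + t)) ≡ n + suc (n + 1) + p + t
    time = solve-∀

  finish : ∀ {m} (d : Fin m → Fin 3) {ls₀ b} →
           ⟪ counting 0F ∣ tape ls₀ ▢ [] , b , tape (word d ʳ++ [ ▢ ]) ▢ [] ⟫
           ↝[ suc (m + 1) ] tabulate (digit ∘ d)
  finish d {ls₀} {b} =
    run (cong (λ o → just ⟪ rewindingOutput ∣ a , b , o ⟫) (act-left (word d ʳ++ [ ▢ ])))
    (rewind (λ o → ⟪ rewindingOutput ∣ a , b , o ⟫) refl d
    (run (cong (λ o → just ⟪ halted ∣ a , b , o ⟫) (act-right (word d ++ [ ▢ ])))
    (_ , halt refl , trans (read-load [ ▢ ] (word d ++ [ ▢ ])) (lettersOf-word d))))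
    where
    a : Tape Letter 0
    a = tape ls₀ ▢ []

  -- The summands follow the phases: start, copying, turning at the separator, rewinding, leaving
  -- the blank, the rows, and the final rewinding of the output.
  steps : ℕ → ℕ
  steps n = suc (n + suc (n + suc (n * (n + suc (n + 1)) + suc (n + 1))))

  machine-computes : ∀ {n} (e : Fin n → Fin n → Fin 3) (f : Fin n → Fin 3) →
    Computes machine (tabulate (digit ∘ f) ++ [ sep ] ++ encodeRows e)
                     (tabulate (digit ∘ relabelRows e f f))
                     (steps n)
  machine-computes {n} e f =
    subst (λ a → ⟪ starting ∣ a , blank , blank ⟫ ↝[ steps n ] tabulate (digit ∘ relabelRows e f f))
      (sym input)
      (run refl
      (copy f {rest = letter sep ∷ rows e} (λ {ls} →
      let a = load (letter sep ∷ ls) (rows e) in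
      run (cong₂ (λ a b → just ⟪ rewindingCopies ∣ a , b , b ⟫)
             (act-right (rows e)) (act-left (word f ʳ++ [ ▢ ])))
      (rewind (λ b → ⟪ rewindingCopies ∣ a , b , b ⟫) refl f
      (run (cong (λ b → just ⟪ counting 0F ∣ a , b , b ⟫) (act-right (word f ++ [ ▢ ])))
      (scanRows e f f (finish (relabelRows e f f))))))))
    where
    input : write (tabulate (digit ∘ f) ++ sep ∷ encodeRows e) ≡ load [] (word f ++ letter sep ∷ rows e)
    input = trans (write-load (tabulate (digit ∘ f) ++ sep ∷ encodeRows e)) (cong (load []) (trans
      (map-++ _ (tabulate (digit ∘ f)) (sep ∷ encodeRows e))
      (cong₂ (λ a b → a ++ letter sep ∷ b) (symbols-tabulate f) (symbols-encodeRows e))))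

  -- The argument `n * suc n` is the size of the graph, and it also absorbs the linear term `3 * n`.
  steps≤ : ∀ n → steps n ℕ.≤ ⟦ 5 ∷ 5 ∷ [] ⟧ (n * suc n)
  steps≤ n = begin
    steps n                                 ≡⟨ expand n ⟩
    5 + (2 * (n * suc n) + 3 * n)           ≤⟨ ℕ.+-monoʳ-≤ 5 (ℕ.+-monoʳ-≤ (2 * (n * suc n))
                                                 (ℕ.*-monoʳ-≤ 3 (ℕ.m≤m*n n (suc n)))) ⟩
    5 + (2 * (n * suc n) + 3 * (n * suc n)) ≡⟨ collect (n * suc n) ⟩
    ⟦ 5 ∷ 5 ∷ [] ⟧ (n * suc n)              ∎
    where
    open ℕ.≤-Reasoning

    expand : ∀ n → suc (n + suc (n + suc (n * (n + suc (n + 1)) + suc (n + 1)))) ≡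
             5 + (2 * (n * suc n) + 3 * n)
    expand = solve-∀

    collect : ∀ s → 5 + (2 * s + 3 * s) ≡ 5 + s * (5 + s * 0)
    collect = solve-∀

  relabel-polynomialTime : ∀ {P Q : (G : Graph) → Pred (Labelling G) 0ℓ}
    (F : (G : Graph) → ∃ (P G) → ∃ (Q G)) →
    (∀ G f → proj₁ (F G f) ≡ relabel G k (proj₁ f)) → PolynomialTime {P} {Q} F
  relabel-polynomialTime F F≡relabel = machine , 5 ∷ 5 ∷ [] , λ G f →
    let n = Graph.order G in
    steps n ,
    subst (λ s → steps n ℕ.≤ ⟦ 5 ∷ 5 ∷ [] ⟧ s) (sym (length-encodeRows (adjacency G))) (steps≤ n) ,
    subst (λ g → Computes machine (encode G (proj₁ f)) (encodeLabelling G g) (steps n))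
          (sym (F≡relabel G f)) (machine-computes (adjacency G) (proj₁ f))

theorem11 : Σ ((G : Graph) → Bijection (𝓡 G) (𝓟 G)) λ B →
    PolynomialTime {IsMinimalRoman} {IsMinimalPerfectRoman} (λ G → Bijection.to (B G)) ×
    PolynomialTime {IsMinimalPerfectRoman} {IsMinimalRoman} (λ G → Bijection.to⁻ (B G))
theorem11 = bijection ,
  relabel-polynomialTime 1F (λ G → Bijection.to (bijection G)) (λ _ _ → refl) ,
  relabel-polynomialTime 0F (λ G → Bijection.to⁻ (bijection G)) (λ _ _ → refl)
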